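{- Let $K$ be an absorptive, fully-continuous commutative semiring and $\mathcal{E}\colon(X=P_X)_{X\in\mathbf{X}}$ a polynomial equation system over $K$ with induced operator $F_\mathcal{E}$. Then for each $X\in\mathbf{X}$, \[ \operatorname{lfp}(F_\mathcal{E})_X=\sum_{\substack{T\in\mathcal{T}(\mathcal{E},X)\\ T\text{ finite}}}\mathsf{yd}(T),\qquad \operatorname{gfp}(F_\mathcal{E})_X=\sum_{T\in\mathcal{T}(\mathcal{E},X)}\mathsf{yd}(T). \]
   Context: Absorptive: $1+a=1$ for all $a$ (implies idempotence); natural order $a\le b$ iff $a+b=b$; fully continuous: $\le$ is a complete lattice and $+$, $\cdot$ with a fixed element commute with suprema and infima of nonempty chains. Infinite sums denote suprema; an infinite product is the infimum of its finite subproducts. A polynomial equation system over $K$ with indeterminates $\mathbf{X}=\{X_1,\dots,X_\ell\}$ assigns to each $X$ a polynomial $P_X$ (finite sum $\sum c_i m_i$, distinct monomials $m_i\colon\mathbf{X}\to\mathbb{N}$, coefficients $c_i\ne0$; write $c\cdot m\in P$ for such a pair); $F_\mathcal{E}(\mathbf{a})_X=P_X(\mathbf{a})$; lfp/gfp are w.r.t. the componentwise natural order. A derivation tree $T=(V,E,\mathsf{var},\mathsf{yd})$ is a rooted, possibly infinite tree with labelings $\mathsf{var}\colon V\to\mathbf{X}$, $\mathsf{yd}\colon V\to K$; $\mathsf{mon}(v)=\prod_{w\text{ child of }v}\mathsf{var}(w)$. $T$ is compatible with $\mathcal{E}$ if $\mathsf{yd}(v)\cdot\mathsf{mon}(v)\in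 P_{\mathsf{var}(v)}$ for every node $v$; $\mathcal{T}(\mathcal{E},X)$ is the set of compatible trees with root labeled $X$; $\mathsf{yd}(T)=\prod_{v\in V}\mathsf{yd}(v)$. -}

module Defs where

open import Level using (Level; _⊔_; Lift; lift) renaming (suc to lsuc)
open import Algebra.Bundles using (CommutativeSemiring)
open import Data.Nat using (ℕ; zero; suc; _<_)
open import Data.Fin using (Fin) renaming (zero to fzero; suc to fsuc; _≟_ to _≟ᶠ_)
open import Data.Vec using (Vec; []; _∷_; tabulate)
open import Data.List using (List; []; _∷_; foldr; filter; length; upTo)
open import Data.List.Relation.Unary.All using (All)
open import Data.List.Relation.Unary.Any using (Any)
open import Data.List.Relation.Unary.AllPairs using (AllPairs)
open import Data.List.Relation.Unary.Unique.Propositional using (Unique)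
open import Data.List.Membership.Propositional using (_∈_)
open import Data.Product using (Σ; _×_; _,_; proj₁; proj₂; ∃)
open import Data.Sum using (_⊎_)
open import Relation.Nullary using (¬_)
open import Relation.Binary.PropositionalEquality using (_≡_; _≢_)

module _ {c ℓ : Level} (K : CommutativeSemiring c ℓ) where
  open CommutativeSemiring K

  _≤ₙ_ : Carrier → Carrier → Set ℓ
  a ≤ₙ b = (a + b) ≈ b

  Absorptive : Set (c ⊔ ℓ)
  Absorptive = ∀ a → (1# + a) ≈ 1#

  IsNonemptyChain : {I : Set (c ⊔ ℓ)} → (I → Carrier) → Set (c ⊔ ℓ)
  IsNonemptyChain {I} f = I × (∀ i j → f i ≤ₙ f j ⊎ f j ≤ₙ f i)

  record FullyContinuous : Set (lsuc (c ⊔ ℓ)) where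
    field
      ⨆ : {I : Set (c ⊔ ℓ)} → (I → Carrier) → Carrier
      ⨆-upper : {I : Set (c ⊔ ℓ)} (f : I → Carrier) (i : I) → f i ≤ₙ ⨆ f
      ⨆-least : {I : Set (c ⊔ ℓ)} (f : I → Carrier) (b : Carrier) →
                (∀ i → f i ≤ₙ b) → ⨆ f ≤ₙ b
      ⨅ : {I : Set (c ⊔ ℓ)} → (I → Carrier) → Carrier
      ⨅-lower : {I : Set (c ⊔ ℓ)} (f : I → Carrier) (i : I) → ⨅ f ≤ₙ f i
      ⨅-greatest : {I : Set (c ⊔ ℓ)} (f : I → Carrier) (b : Carrier) →
                   (∀ i → b ≤ₙ f i) → b ≤ₙ ⨅ f
      +-⨆ : {I : Set (c ⊔ ℓ)} (f : I → Carrier) → IsNonemptyChain f →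
            ∀ a → (a + ⨆ f) ≈ ⨆ (λ i → a + f i)
      *-⨆ : {I : Set (c ⊔ ℓ)} (f : I → Carrier) → IsNonemptyChain f →
            ∀ a → (a * ⨆ f) ≈ ⨆ (λ i → a * f i)
      +-⨅ : {I : Set (c ⊔ ℓ)} (f : I → Carrier) → IsNonemptyChain f →
            ∀ a → (a + ⨅ f) ≈ ⨅ (λ i → a + f i)
      *-⨅ : {I : Set (c ⊔ ℓ)} (f : I → Carrier) → IsNonemptyChain f →
            ∀ a → (a * ⨅ f) ≈ ⨅ (λ i → a * f i)

  Monomial : ℕ → Set
  Monomial n = Vec ℕ n

  Poly : ℕ → Set c
  Poly n = List (Carrier × Monomial n)

  WellFormedPoly : {n : ℕ} → Poly n → Set (c ⊔ ℓ)
  WellFormedPoly P =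
    AllPairs (λ t u → proj₂ t ≢ proj₂ u) P × All (λ t → ¬ (proj₁ t ≈ 0#)) P

  System : ℕ → Set c
  System n = Fin n → Poly n

  WellFormedSystem : {n : ℕ} → System n → Set (c ⊔ ℓ)
  WellFormedSystem E = ∀ X → WellFormedPoly (E X)

  pow : Carrier → ℕ → Carrier
  pow a zero = 1#
  pow a (suc k) = a * pow a k

  evalMon : {n : ℕ} → Monomial n → (Fin n → Carrier) → Carrier
  evalMon [] a = 1#
  evalMon (k ∷ m) a = pow (a fzero) k * evalMon m (λ i → a (fsuc i))

  evalPoly : {n : ℕ} → Poly n → (Fin n → Carrier) → Carrier
  evalPoly P a = foldr (λ t acc → (proj₁ t * evalMon (proj₂ t) a) + acc) 0# P

  F : {n : ℕ} → System n → (Fin n → Carrier) → (Fin n → Carrier)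
  F E a X = evalPoly (E X) a

  _≤ᵛ_ : {n : ℕ} → (Fin n → Carrier) → (Fin n → Carrier) → Set ℓ
  a ≤ᵛ b = ∀ X → a X ≤ₙ b X

  IsFixedPoint : {n : ℕ} → System n → (Fin n → Carrier) → Set ℓ
  IsFixedPoint E a = ∀ X → F E a X ≈ a X

  IsLfp : {n : ℕ} → System n → (Fin n → Carrier) → Set (c ⊔ ℓ)
  IsLfp E a = IsFixedPoint E a × (∀ b → IsFixedPoint E b → a ≤ᵛ b)

  IsGfp : {n : ℕ} → System n → (Fin n → Carrier) → Set (c ⊔ ℓ)
  IsGfp E a = IsFixedPoint E a × (∀ b → IsFixedPoint E b → b ≤ᵛ a)

  -- Derivation trees (possibly infinite), nodes addressed by paths.
  -- A path is a list of child indices (most recent step first); the root is [].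

  record Tree (n : ℕ) : Set c where
    field
      arity : List ℕ → ℕ
      var   : List ℕ → Fin n
      yd    : List ℕ → Carrier

  data IsNode (ar : List ℕ → ℕ) : List ℕ → Set where
    root  : IsNode ar []
    child : ∀ {p i} → IsNode ar p → i < ar p → IsNode ar (i ∷ p)

  module _ {n : ℕ} (T : Tree n) where
    open Tree T

    Node : List ℕ → Set
    Node = IsNode arity

    -- mon(v) = ∏_{w child of v} var(w), as exponent vector
    mon : List ℕ → Monomial n
    mon p = tabulate (λ X → length (filter (λ i → var (i ∷ p) ≟ᶠ X) (upTo (arity p))))

    Compatible : System n → Set (c ⊔ ℓ)
    Compatible E = ∀ p → Node p →
      Any (λ t → (proj₁ t ≈ yd p) × (proj₂ t ≡ mon p)) (E (var p))

    Finite : Set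
    Finite = Σ (List (List ℕ)) (λ xs → ∀ p → Node p → p ∈ xs)

    FinNodeSet : Set
    FinNodeSet = Σ (List (List ℕ)) (λ xs → Unique xs × All Node xs)

    prodList : List (List ℕ) → Carrier
    prodList xs = foldr (λ p acc → yd p * acc) 1# xs

  module _ (FC : FullyContinuous) where
    open FullyContinuous FC

    -- yd(T) = ∏_{v ∈ V} yd(v), the infimum of its finite subproducts
    ydT : {n : ℕ} → Tree n → Carrier
    ydT T = ⨅ {I = Lift (c ⊔ ℓ) (FinNodeSet T)} (λ S → prodList T (proj₁ (Lift.lower S)))

    InT : {n : ℕ} → System n → Fin n → Tree n → Set (c ⊔ ℓ)
    InT E X T = Compatible T E × (Tree.var T [] ≡ X)

    sumFiniteTrees : {n : ℕ} → System n → Fin n → Carrier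
    sumFiniteTrees {n} E X =
      ⨆ {I = Σ (Tree n) (λ T → InT E X T × Finite T)} (λ t → ydT (proj₁ t))

    sumAllTrees : {n : ℕ} → System n → Fin n → Carrier
    sumAllTrees {n} E X =
      ⨆ {I = Σ (Tree n) (λ T → InT E X T)} (λ t → ydT (proj₁ t))

{-# OPTIONS --safe #-}
module Submission where

-- Both fixed points are Kleene iterates, since continuity on chains makes the operator continuous
-- on ω-sequences. Cutting a tree at depth k bounds its yield by the k-th iterate, so the tree sums
-- lie below the iterates; conversely the k-th iterate of 0 expands into finitely many finite trees.
-- The remaining inequality, gfp ≤ Σ yd(T), cannot be read off from truncations, as an infimum of
-- growing finite sums need not be a sum of infima. Instead the variables of b ≤ F(b) are eliminated
-- one after the other: absorption makes each inequality linear, x ≤ a + p x, whence x ≤ a + p^∞ by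
-- continuity. Every p^∞ corresponds to repeating a piece of tree forever, so b ends up below a finite
-- sum of weights of rational trees, each of which is at most the yield of its unfolding.

open import Defs
open import Level using (Level; _⊔_; Lift; lift; lower)
open import Algebra.Bundles using (CommutativeSemiring)
open import Algebra.Properties.CommutativeSemigroup using (interchange; x∙yz≈y∙xz)
open import Data.Bool using (true; false; if_then_else_)
open import Data.Empty using (⊥-elim)
open import Data.Fin using (Fin) renaming (zero to fzero; suc to fsuc; _≟_ to _≟ᶠ_)
open import Data.Fin.Subset using (Subset; ∣_∣) renaming (⊤ to full; _∉_ to _∉ˢ_; _-_ to _-ˢ_)
open import Data.Fin.Subset.Properties using (x∈p∧x≢y⇒x∈p-y; x∈p⇒∣p-x∣<∣p∣; ∈⊤; _∈?_)
open import Data.List using (List; []; _∷_; _++_; _∷ʳ_; foldr; filter; length; upTo; applyUpTo; map; concatMap; replicate)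
open import Data.List.Properties using (filter-++; length-++; ++-cancelʳ; ∷ʳ-injectiveʳ; ∷ʳ-++; map-upTo; map-∘)
open import Data.List.Membership.Propositional using (_∈_; lose; find)
open import Data.List.Membership.Propositional.Properties
  using (∈-∃++; ∈-++⁺ˡ; ∈-++⁺ʳ; ∈-++⁻; ∈-concatMap⁺; ∈-concatMap⁻; ∈-upTo⁺; ∈-upTo⁻; ∈-filter⁺; ∈-filter⁻)
open import Data.List.Relation.Binary.Disjoint.Propositional using (Disjoint)
open import Data.List.Relation.Unary.All as All using (All; []; _∷_)
import Data.List.Relation.Unary.All.Properties as All
open import Data.List.Relation.Unary.AllPairs as AllPairs using ([]; _∷_)
import Data.List.Relation.Unary.AllPairs.Properties as AllPairs
open import Data.List.Relation.Unary.Any using (here; there; any?)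
open import Data.List.Relation.Unary.Unique.Propositional using (Unique)
import Data.List.Relation.Unary.Unique.Propositional.Properties as Unique
open import Data.Nat using (ℕ; zero; suc; z≤n; s≤s) renaming (_+_ to _+ℕ_; _≤_ to _≤ℕ_; _<_ to _<ℕ_; _⊔_ to _⊔ℕ_)
import Data.Nat.Properties as ℕ
open import Data.Product using (Σ; ∃; _×_; _,_; proj₁; proj₂)
open import Data.Sum using (inj₁; inj₂; [_,_]′)
open import Data.Vec using (Vec; []; _∷_; tabulate; lookup)
open import Data.Vec.Properties using (tabulate∘lookup; tabulate-cong)
open import Function using (_∘_; id)
open import Relation.Binary.Bundles using (Poset)
open import Relation.Binary.PropositionalEquality as ≡ using (_≡_; _≢_)
import Relation.Binary.Reasoning.PartialOrder as PosetReasoning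
open import Relation.Nullary using (¬_; yes; no; does)
open import Relation.Nullary.Decidable using (¬?)

-- The natural order of an absorptive semiring, finite sums and products, finite covers

module OrderedSemiring {c ℓ : Level} (K : CommutativeSemiring c ℓ) (absorptive : Absorptive K) where
  open CommutativeSemiring K public

  infix 4 _≤_
  _≤_ : Carrier → Carrier → Set ℓ
  _≤_ = _≤ₙ_ K

  +-idem : ∀ a → a + a ≈ a
  +-idem a = begin
    a + a           ≈⟨ +-cong (*-identityʳ a) (*-identityʳ a) ⟨
    a * 1# + a * 1# ≈⟨ distribˡ a 1# 1# ⟨
    a * (1# + 1#)   ≈⟨ *-congˡ (absorptive 1#) ⟩
    a * 1#          ≈⟨ *-identityʳ a ⟩
    a               ∎
    where open import Relation.Binary.Reasoning.Setoid setoid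

  ≤-poset : Poset c ℓ ℓ
  ≤-poset = record
    { Carrier = Carrier
    ; _≈_ = _≈_
    ; _≤_ = _≤_
    ; isPartialOrder = record
      { isPreorder = record
        { isEquivalence = isEquivalence
        ; reflexive = λ {a} a≈b → trans (+-congˡ (sym a≈b)) (trans (+-idem a) a≈b)
        ; trans = λ {a} {b} {d} a≤b b≤d →
            trans (+-congˡ (sym b≤d)) (trans (sym (+-assoc a b d)) (trans (+-congʳ a≤b) b≤d))
        }
      ; antisym = λ {a} {b} a≤b b≤a → trans (sym b≤a) (trans (+-comm b a) a≤b)
      }
    }

  open Poset ≤-poset public
    using () renaming (refl to ≤-refl; trans to ≤-trans; reflexive to ≤-reflexive; antisym to ≤-antisym)
  module ≤-Reasoning = PosetReasoning ≤-poset
  open ≤-Reasoning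

  x≤x+y : ∀ x y → x ≤ x + y
  x≤x+y x y = trans (sym (+-assoc x x y)) (+-congʳ (+-idem x))

  y≤x+y : ∀ x y → y ≤ x + y
  y≤x+y x y = ≤-trans (x≤x+y y x) (≤-reflexive (+-comm y x))

  +-lub : ∀ {x y z} → x ≤ z → y ≤ z → x + y ≤ z
  +-lub {x} {y} {z} x≤z y≤z = trans (+-assoc x y z) (trans (+-congˡ y≤z) x≤z)

  +-mono : ∀ {x y u v} → x ≤ y → u ≤ v → x + u ≤ y + v
  +-mono {x} {y} {u} {v} p q = +-lub (≤-trans p (x≤x+y y v)) (≤-trans q (y≤x+y y v))

  *-monoʳ : ∀ x {y z} → y ≤ z → x * y ≤ x * z
  *-monoʳ x {y} {z} y≤z = trans (sym (distribˡ x y z)) (*-congˡ y≤z)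

  *-mono : ∀ {x y u v} → x ≤ y → u ≤ v → x * u ≤ y * v
  *-mono {x} {y} {u} {v} p q = begin
    x * u ≤⟨ *-monoʳ x q ⟩
    x * v ≈⟨ *-comm x v ⟩
    v * x ≤⟨ *-monoʳ v p ⟩
    v * y ≈⟨ *-comm v y ⟩
    y * v ∎

  0≤ : ∀ x → 0# ≤ x
  0≤ = +-identityˡ

  ≤1 : ∀ x → x ≤ 1#
  ≤1 x = trans (+-comm x 1#) (absorptive x)

  x*y≤y : ∀ x y → x * y ≤ y
  x*y≤y x y = ≤-trans (*-mono (≤1 x) ≤-refl) (≤-reflexive (*-identityˡ y))

  x*y≤x : ∀ x y → x * y ≤ x
  x*y≤x x y = ≤-trans (≤-reflexive (*-comm x y)) (x*y≤y y x)

  *-interchange : ∀ w x y z → (w * x) * (y * z) ≈ (w * y) * (x * z)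
  *-interchange = interchange *-commutativeSemigroup

  *-swap : ∀ x y z → x * (y * z) ≈ y * (x * z)
  *-swap = x∙yz≈y∙xz *-commutativeSemigroup

  private variable
    a b : Level
    A : Set a
    B : Set b

  sum : (A → Carrier) → List A → Carrier
  sum f = foldr (λ x s → f x + s) 0#

  prod : (A → Carrier) → List A → Carrier
  prod f = foldr (λ x s → f x * s) 1#

  sum-least : ∀ (f : A → Carrier) {y} xs → (∀ x → f x ≤ y) → sum f xs ≤ y
  sum-least f {y} []       f≤y = 0≤ y
  sum-least f     (x ∷ xs) f≤y = +-lub (f≤y x) (sum-least f xs f≤y)

  sum-mono : {f : A → Carrier} {g : B → Carrier} (h : A → B) → (∀ x → f x ≤ g (h x)) →
             ∀ xs → sum f xs ≤ sum g (map h xs)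
  sum-mono h f≤g []       = ≤-refl
  sum-mono h f≤g (x ∷ xs) = +-mono (f≤g x) (sum-mono h f≤g xs)

  sum-++ : ∀ (f : A → Carrier) xs ys → sum f (xs ++ ys) ≈ sum f xs + sum f ys
  sum-++ f []       ys = sym (+-identityˡ _)
  sum-++ f (x ∷ xs) ys = trans (+-congˡ (sum-++ f xs ys)) (sym (+-assoc _ _ _))

  prod-++ : ∀ (f : A → Carrier) xs ys → prod f (xs ++ ys) ≈ prod f xs * prod f ys
  prod-++ f []       ys = sym (*-identityˡ _)
  prod-++ f (x ∷ xs) ys = trans (*-congˡ (prod-++ f xs ys)) (sym (*-assoc _ _ _))

  prod-map : ∀ (f : B → Carrier) (g : A → B) xs → prod f (map g xs) ≡ prod (f ∘ g) xs
  prod-map f g []       = ≡.refl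
  prod-map f g (x ∷ xs) = ≡.cong (f (g x) *_) (prod-map f g xs)

  prod-mono : ∀ {f g : A → Carrier} xs → (∀ {x} → x ∈ xs → f x ≤ g x) → prod f xs ≤ prod g xs
  prod-mono []       f≤g = ≤-refl
  prod-mono (x ∷ xs) f≤g = *-mono (f≤g (here ≡.refl)) (prod-mono xs (f≤g ∘ there))

  prod-concatMap : ∀ (f : B → Carrier) (g : A → List B) xs →
                   prod f (concatMap g xs) ≈ prod (prod f ∘ g) xs
  prod-concatMap f g []       = refl
  prod-concatMap f g (x ∷ xs) = trans (prod-++ f (g x) (concatMap g xs)) (*-congˡ (prod-concatMap f g xs))

  -- All factors are at most `1#`, so further factors only make a product smaller. Uniqueness of
  -- `xs` lets each of its elements use up its own occurrence in `ys`.
  prod-antitone : ∀ (f : A → Carrier) {xs ys} → Unique xs → (∀ {x} → x ∈ xs → x ∈ ys) →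
                  prod f ys ≤ prod f xs
  prod-antitone f {[]}     {ys} []         xs⊆ys = ≤1 _
  prod-antitone f {x ∷ xs} (x∉xs ∷ xs!) xs⊆ys with ∈-∃++ (xs⊆ys (here ≡.refl))
  ... | us , vs , ≡.refl = begin
    prod f (us ++ x ∷ vs)          ≈⟨ prod-++ f us (x ∷ vs) ⟩
    prod f us * (f x * prod f vs)  ≈⟨ *-swap _ _ _ ⟩
    f x * (prod f us * prod f vs)  ≈⟨ *-congˡ (prod-++ f us vs) ⟨
    f x * prod f (us ++ vs)        ≤⟨ *-monoʳ (f x) (prod-antitone f xs! remaining) ⟩
    f x * prod f xs                ∎
    where
    remaining : ∀ {z} → z ∈ xs → z ∈ us ++ vs
    remaining z∈xs with ∈-++⁻ us (xs⊆ys (there z∈xs))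
    ... | inj₁ z∈us            = ∈-++⁺ˡ z∈us
    ... | inj₂ (here ≡.refl)   = ⊥-elim (All.lookup x∉xs z∈xs ≡.refl)
    ... | inj₂ (there z∈vs)    = ∈-++⁺ʳ us z∈vs

  -- The shape shared by both hard inequalities: expanded iterates and eliminated variables end up
  -- below a finite sum whose summands are indexed by syntax. Keeping the index list explicit lets
  -- products be multiplied out and summands be replaced one at a time.
  Cover : (A → Carrier) → Carrier → Set _
  Cover {A = A} v x = Σ (List A) λ is → x ≤ sum v is

  cover-map : {v : A → Carrier} {u : B → Carrier} (h : A → B) → (∀ i → v i ≤ u (h i)) →
              ∀ {x} → Cover v x → Cover u x
  cover-map h v≤u (is , x≤) = map h is , ≤-trans x≤ (sum-mono h v≤u is)

  cover-single : (v : A → Carrier) (i : A) → ∀ {x} → x ≤ v i → Cover v x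
  cover-single v i x≤ = i ∷ [] , ≤-trans x≤ (x≤x+y _ _)

  cover-+ : {v : A → Carrier} → ∀ {x y} → Cover v x → Cover v y → Cover v (x + y)
  cover-+ {v = v} (is , x≤) (js , y≤) =
    is ++ js , ≤-trans (+-mono x≤ y≤) (≤-reflexive (sym (sum-++ v is js)))

  cover-* : {v : A → Carrier} {u : B → Carrier} → ∀ {x y} → Cover v x → Cover u y →
            Cover (λ (ij : A × B) → v (proj₁ ij) * u (proj₂ ij)) (x * y)
  cover-* {A = A} {B = B} {v} {u} {x} {y} (is , x≤) (js , y≤) =
    proj₁ (go is) , ≤-trans (*-mono x≤ y≤) (proj₂ (go is))
    where
    go : ∀ is → Cover (λ (ij : A × B) → v (proj₁ ij) * u (proj₂ ij)) (sum v is * sum u js)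
    go []       = [] , ≤-reflexive (zeroˡ _)
    go (i ∷ is) with cover-+ {x = v i * sum u js} (map (i ,_) js , row js) (go is)
      where
      row : ∀ js → v i * sum u js ≤ sum (λ (ij : A × B) → v (proj₁ ij) * u (proj₂ ij)) (map (i ,_) js)
      row []       = ≤-reflexive (zeroʳ _)
      row (j ∷ js) = ≤-trans (≤-reflexive (distribˡ _ _ _)) (+-mono ≤-refl (row js))
    ... | ks , p = ks , ≤-trans (≤-reflexive (distribʳ _ _ _)) p

-- Continuity along sequences and the infinite power

module ContinuousSemiring {c ℓ : Level} (K : CommutativeSemiring c ℓ) (absorptive : Absorptive K)
                          (FC : FullyContinuous K) where
  open OrderedSemiring K absorptive public
  open FullyContinuous FC public
  open ≤-Reasoning

  ⨅ω ⨆ω : (ℕ → Carrier) → Carrier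
  ⨅ω f = ⨅ {I = Lift (c ⊔ ℓ) ℕ} (f ∘ lower)
  ⨆ω f = ⨆ {I = Lift (c ⊔ ℓ) ℕ} (f ∘ lower)

  ⨅ω-lower : ∀ f k → ⨅ω f ≤ f k
  ⨅ω-lower f k = ⨅-lower (f ∘ lower) (lift k)

  ⨅ω-greatest : ∀ f {x} → (∀ k → x ≤ f k) → x ≤ ⨅ω f
  ⨅ω-greatest f x≤ = ⨅-greatest (f ∘ lower) _ (x≤ ∘ lower)

  ⨆ω-upper : ∀ f k → f k ≤ ⨆ω f
  ⨆ω-upper f k = ⨆-upper (f ∘ lower) (lift k)

  ⨆ω-least : ∀ f {x} → (∀ k → f k ≤ x) → ⨆ω f ≤ x
  ⨆ω-least f ≤x = ⨆-least (f ∘ lower) _ (≤x ∘ lower)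

  Ascending Descending : (ℕ → Carrier) → Set ℓ
  Ascending  f = ∀ {j k} → j ≤ℕ k → f j ≤ f k
  Descending f = ∀ {j k} → j ≤ℕ k → f k ≤ f j

  ascending-chain : ∀ {f} → Ascending f → IsNonemptyChain K {I = Lift (c ⊔ ℓ) ℕ} (f ∘ lower)
  ascending-chain asc = lift 0 , λ (lift j) (lift k) →
    [ (λ j≤k → inj₁ (asc j≤k)) , (λ k≤j → inj₂ (asc k≤j)) ]′ (ℕ.≤-total j k)

  descending-chain : ∀ {f} → Descending f → IsNonemptyChain K {I = Lift (c ⊔ ℓ) ℕ} (f ∘ lower)
  descending-chain desc = lift 0 , λ (lift j) (lift k) →
    [ (λ j≤k → inj₂ (desc j≤k)) , (λ k≤j → inj₁ (desc k≤j)) ]′ (ℕ.≤-total j k)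

  -- Continuity acts on one argument at a time and turns the right side into a double infimum. The
  -- diagonal bounds it: at index `j ⊔ℕ k` both descending sequences lie below their values at `j`
  -- and at `k`. The two lemmas on products below follow the same pattern.
  ⨅ω-+ : ∀ {f g} → Descending f → Descending g → ⨅ω (λ k → f k + g k) ≤ ⨅ω f + ⨅ω g
  ⨅ω-+ {f} {g} df dg = begin
    ⨅ω (λ k → f k + g k)      ≤⟨ ⨅ω-greatest _ (λ k → outer k) ⟩
    ⨅ω (λ k → ⨅ω f + g k)     ≈⟨ +-⨅ _ (descending-chain dg) (⨅ω f) ⟨
    ⨅ω f + ⨅ω g               ∎
    where
    outer : ∀ k → ⨅ω (λ k → f k + g k) ≤ ⨅ω f + g k
    outer k = begin
      ⨅ω (λ k → f k + g k)    ≤⟨ ⨅ω-greatest _ (λ j → ≤-trans (⨅ω-lower _ (j ⊔ℕ k))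
                                   (+-lub (≤-trans (df (ℕ.m≤m⊔n j k)) (y≤x+y _ _))
                                          (≤-trans (dg (ℕ.m≤n⊔m j k)) (x≤x+y _ _)))) ⟩
      ⨅ω (λ j → g k + f j)    ≈⟨ +-⨅ _ (descending-chain df) (g k) ⟨
      g k + ⨅ω f              ≈⟨ +-comm _ _ ⟩
      ⨅ω f + g k              ∎

  ⨅ω-* : ∀ {f g} → Descending f → Descending g → ⨅ω (λ k → f k * g k) ≤ ⨅ω f * ⨅ω g
  ⨅ω-* {f} {g} df dg = begin
    ⨅ω (λ k → f k * g k)      ≤⟨ ⨅ω-greatest _ (λ k → outer k) ⟩
    ⨅ω (λ k → ⨅ω f * g k)     ≈⟨ *-⨅ _ (descending-chain dg) (⨅ω f) ⟨
    ⨅ω f * ⨅ω g               ∎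
    where
    outer : ∀ k → ⨅ω (λ k → f k * g k) ≤ ⨅ω f * g k
    outer k = begin
      ⨅ω (λ k → f k * g k)    ≤⟨ ⨅ω-greatest _ (λ j → ≤-trans (⨅ω-lower _ (j ⊔ℕ k))
                                   (≤-trans (≤-reflexive (*-comm _ _))
                                     (*-mono (dg (ℕ.m≤n⊔m j k)) (df (ℕ.m≤m⊔n j k))))) ⟩
      ⨅ω (λ j → g k * f j)    ≈⟨ *-⨅ _ (descending-chain df) (g k) ⟨
      g k * ⨅ω f              ≈⟨ *-comm _ _ ⟩
      ⨅ω f * g k              ∎

  ⨆ω-* : ∀ {f g} → Ascending f → Ascending g → ⨆ω f * ⨆ω g ≤ ⨆ω (λ k → f k * g k)
  ⨆ω-* {f} {g} af ag = begin
    ⨆ω f * ⨆ω g               ≈⟨ *-⨆ _ (ascending-chain ag) (⨆ω f) ⟩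
    ⨆ω (λ k → ⨆ω f * g k)     ≤⟨ ⨆ω-least _ (λ k → outer k) ⟩
    ⨆ω (λ k → f k * g k)      ∎
    where
    outer : ∀ k → ⨆ω f * g k ≤ ⨆ω (λ k → f k * g k)
    outer k = begin
      ⨆ω f * g k              ≈⟨ *-comm _ _ ⟩
      g k * ⨆ω f              ≈⟨ *-⨆ _ (ascending-chain af) (g k) ⟩
      ⨆ω (λ j → g k * f j)    ≤⟨ ⨆ω-least _ (λ j → ≤-trans
                                   (≤-trans (≤-reflexive (*-comm _ _))
                                     (*-mono (af (ℕ.m≤m⊔n j k)) (ag (ℕ.m≤n⊔m j k))))
                                   (⨆ω-upper _ (j ⊔ℕ k))) ⟩
      ⨆ω (λ k → f k * g k)    ∎

  infixl 9 _^_ _^∞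
  _^_ : Carrier → ℕ → Carrier
  _^_ = pow K

  _^∞ : Carrier → Carrier
  x ^∞ = ⨅ω (x ^_)

  ^-mono : ∀ {x y} → x ≤ y → ∀ k → x ^ k ≤ y ^ k
  ^-mono x≤y zero    = ≤-refl
  ^-mono x≤y (suc k) = *-mono x≤y (^-mono x≤y k)

  ^-descending : ∀ x → Descending (x ^_)
  ^-descending x z≤n       = ≤1 _
  ^-descending x (s≤s j≤k) = *-monoʳ x (^-descending x j≤k)

  ^∞≤ : ∀ x → x ^∞ ≤ x
  ^∞≤ x = ≤-trans (⨅ω-lower _ 1) (≤-reflexive (*-identityʳ x))

  ^∞-mono : ∀ {x y} → x ≤ y → x ^∞ ≤ y ^∞
  ^∞-mono x≤y = ⨅ω-greatest _ λ k → ≤-trans (⨅ω-lower _ k) (^-mono x≤y k)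

  ^∞-unfold : ∀ x → x ^∞ ≤ x * x ^∞
  ^∞-unfold x = begin
    x ^∞                    ≤⟨ ⨅ω-greatest _ (λ k → ⨅ω-lower _ (suc k)) ⟩
    ⨅ω (λ k → x * x ^ k)    ≈⟨ *-⨅ _ (descending-chain (^-descending x)) x ⟨
    x * x ^∞                ∎

  -- Any finite number of factors can be split off `x ^∞`, and continuity carries this to the
  -- infimum. An infinite supply can thus be shared among several consumers.
  ^∞-idem : ∀ x → x ^∞ ≤ x ^∞ * x ^∞
  ^∞-idem x = begin
    x ^∞                      ≤⟨ ⨅ω-greatest _ absorb ⟩
    ⨅ω (λ k → x ^∞ * x ^ k)   ≈⟨ *-⨅ _ (descending-chain (^-descending x)) (x ^∞) ⟨
    x ^∞ * x ^∞               ∎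
    where
    absorb : ∀ k → x ^∞ ≤ x ^∞ * x ^ k
    absorb zero    = ≤-reflexive (sym (*-identityʳ _))
    absorb (suc k) = begin
      x ^∞               ≤⟨ ^∞-unfold x ⟩
      x * x ^∞           ≤⟨ *-monoʳ x (absorb k) ⟩
      x * (x ^∞ * x ^ k) ≈⟨ *-swap _ _ _ ⟩
      x ^∞ * x ^ suc k   ∎

  idem⇒≤^∞ : ∀ {x} → x ≤ x * x → x ≤ x ^∞
  idem⇒≤^∞ {x} x≤x² = ⨅ω-greatest _ go
    where
    go : ∀ k → x ≤ x ^ k
    go zero    = ≤1 x
    go (suc k) = ≤-trans x≤x² (*-monoʳ x (go k))

  -- Of two copies of the infinite power, one keeps only its factors `x` and the other a single `y`.
  -- In the elimination this counts the remaining open references of a loop just once.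
  ^∞-* : ∀ x y → (x * y) ^∞ ≤ x ^∞ * y
  ^∞-* x y = begin
    (x * y) ^∞              ≤⟨ ^∞-idem (x * y) ⟩
    (x * y) ^∞ * (x * y) ^∞ ≤⟨ *-mono (^∞-mono (x*y≤x x y)) (≤-trans (^∞≤ (x * y)) (x*y≤y x y)) ⟩
    x ^∞ * y                ∎

  -- Substituting the inequality into itself yields the bounds `a + p ^ k`, since `p * a` is
  -- absorbed by `a` each time. Continuity of `+` then moves the infimum inside.
  linear-post-fixed : ∀ {x a p} → x ≤ a + p * x → x ≤ a + p ^∞
  linear-post-fixed {x} {a} {p} x≤a+px = begin
    x                     ≤⟨ ⨅ω-greatest _ iterate ⟩
    ⨅ω (λ k → a + p ^ k)  ≈⟨ +-⨅ _ (descending-chain (^-descending p)) a ⟨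
    a + p ^∞              ∎
    where
    iterate : ∀ k → x ≤ a + p ^ k
    iterate zero    = ≤-trans (≤1 x) (y≤x+y a 1#)
    iterate (suc k) = begin
      x                 ≤⟨ x≤a+px ⟩
      a + p * x         ≤⟨ +-mono ≤-refl (*-monoʳ p (iterate k)) ⟩
      a + p * (a + p ^ k) ≈⟨ +-congˡ (distribˡ p a (p ^ k)) ⟩
      a + (p * a + p * p ^ k) ≤⟨ +-lub (x≤x+y _ _) (+-mono (x*y≤y p a) ≤-refl) ⟩
      a + p ^ suc k     ∎

-- Monomials as words of variables

nth : ∀ {a} {A : Set a} → A → List A → ℕ → A
nth d []       _       = d
nth d (x ∷ xs) zero    = x
nth d (x ∷ xs) (suc i) = nth d xs i

nth-∈ : ∀ {a} {A : Set a} (d : A) {xs i} → i <ℕ length xs → nth d xs i ∈ xs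
nth-∈ d {x ∷ xs} {zero}  _        = here ≡.refl
nth-∈ d {x ∷ xs} {suc i} (s≤s i<) = there (nth-∈ d i<)

map-nth-upTo : ∀ {a} {A : Set a} (d : A) xs → map (nth d xs) (upTo (length xs)) ≡ xs
map-nth-upTo d xs = ≡.trans (map-upTo (nth d xs) (length xs)) (go xs)
  where
  go : ∀ xs → applyUpTo (nth d xs) (length xs) ≡ xs
  go []       = ≡.refl
  go (x ∷ xs) = ≡.cong (x ∷_) (go xs)

-- Fixes an order on the variable occurrences of a monomial, so that each occurrence becomes a
-- separate child position.
expand : ∀ {n} → Vec ℕ n → List (Fin n)
expand []      = []
expand (k ∷ m) = replicate k fzero ++ map fsuc (expand m)

count : ∀ {n} → Fin n → List (Fin n) → ℕ
count X ys = length (filter (_≟ᶠ X) ys)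

exponents : ∀ {n} → List (Fin n) → Vec ℕ n
exponents ys = tabulate (λ X → count X ys)

count-++ : ∀ {n} (X : Fin n) xs ys → count X (xs ++ ys) ≡ count X xs +ℕ count X ys
count-++ X xs ys =
  ≡.trans (≡.cong length (filter-++ (_≟ᶠ X) xs ys)) (length-++ (filter (_≟ᶠ X) xs))

count-zero-replicate : ∀ {n} k → count (fzero {n}) (replicate k fzero) ≡ k
count-zero-replicate zero    = ≡.refl
count-zero-replicate (suc k) = ≡.cong suc (count-zero-replicate k)

count-suc-replicate : ∀ {n} (X : Fin n) k → count (fsuc X) (replicate k fzero) ≡ 0
count-suc-replicate X zero    = ≡.refl
count-suc-replicate X (suc k) = count-suc-replicate X k

count-zero-map-suc : ∀ {n} (ys : List (Fin n)) → count fzero (map fsuc ys) ≡ 0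
count-zero-map-suc []       = ≡.refl
count-zero-map-suc (y ∷ ys) = count-zero-map-suc ys

count-suc-map-suc : ∀ {n} (X : Fin n) ys → count (fsuc X) (map fsuc ys) ≡ count X ys
count-suc-map-suc X []       = ≡.refl
count-suc-map-suc X (y ∷ ys) with does (y ≟ᶠ X)
... | true  = ≡.cong suc (count-suc-map-suc X ys)
... | false = count-suc-map-suc X ys

count-expand : ∀ {n} (m : Vec ℕ n) X → count X (expand m) ≡ lookup m X
count-expand (k ∷ m) fzero = ≡.trans (count-++ fzero (replicate k fzero) _)
  (≡.trans (≡.cong₂ _+ℕ_ (count-zero-replicate k) (count-zero-map-suc (expand m))) (ℕ.+-identityʳ k))
count-expand (k ∷ m) (fsuc X) = ≡.trans (count-++ (fsuc X) (replicate k fzero) _)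
  (≡.cong₂ _+ℕ_ (count-suc-replicate X k) (≡.trans (count-suc-map-suc X (expand m)) (count-expand m X)))

exponents-expand : ∀ {n} (m : Vec ℕ n) → exponents (expand m) ≡ m
exponents-expand m = ≡.trans (tabulate-cong (count-expand m)) (tabulate∘lookup m)

-- `mon` filters child indices by their labels, whereas `count` filters the labels themselves; this
-- links the two.
length-filter-map : ∀ {a} {A : Set a} {n} (f : A → Fin n) X xs →
                    length (filter (λ x → f x ≟ᶠ X) xs) ≡ count X (map f xs)
length-filter-map f X []       = ≡.refl
length-filter-map f X (x ∷ xs) with does (f x ≟ᶠ X)
... | true  = ≡.cong suc (length-filter-map f X xs)
... | false = length-filter-map f X xs

-- Continuity of the polynomial operator and its Kleene iterates

module Approximation {c ℓ : Level} (K : CommutativeSemiring c ℓ) (absorptive : Absorptive K)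
                     (FC : FullyContinuous K) {n : ℕ} (E : System K n) where
  open ContinuousSemiring K absorptive FC public
  open ≤-Reasoning

  Valuation : Set c
  Valuation = Fin n → Carrier

  infix 4 _≼_
  _≼_ : Valuation → Valuation → Set ℓ
  _≼_ = _≤ᵛ_ K

  ⟦_⟧ : Valuation → Valuation
  ⟦_⟧ = F K E

  ^-+ : ∀ x j k → x ^ (j +ℕ k) ≈ x ^ j * x ^ k
  ^-+ x zero    k = sym (*-identityˡ _)
  ^-+ x (suc j) k = trans (*-congˡ (^-+ x j k)) (sym (*-assoc _ _ _))

  evalMon-zero : ∀ {m} (a : Fin m → Carrier) → evalMon K (tabulate (λ _ → 0)) a ≈ 1#
  evalMon-zero {zero}  a = refl
  evalMon-zero {suc m} a = trans (*-identityˡ _) (evalMon-zero (a ∘ fsuc))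

  evalMon-+ : ∀ {m} (f g : Fin m → ℕ) a →
    evalMon K (tabulate (λ X → f X +ℕ g X)) a ≈ evalMon K (tabulate f) a * evalMon K (tabulate g) a
  evalMon-+ {zero}  f g a = sym (*-identityˡ _)
  evalMon-+ {suc m} f g a =
    trans (*-cong (^-+ (a fzero) (f fzero) (g fzero)) (evalMon-+ (f ∘ fsuc) (g ∘ fsuc) (a ∘ fsuc)))
          (*-interchange _ _ _ _)

  evalMon-indicator : ∀ {m} (Y : Fin m) a →
    evalMon K (tabulate (λ X → if does (Y ≟ᶠ X) then 1 else 0)) a ≈ a Y
  evalMon-indicator fzero    a = trans (*-cong (*-identityʳ _) (evalMon-zero (a ∘ fsuc))) (*-identityʳ _)
  evalMon-indicator (fsuc Y) a = trans (*-identityˡ _) (evalMon-indicator Y (a ∘ fsuc))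

  -- Each letter adds the indicator vector of its variable, and evaluation turns sums of exponent
  -- vectors into products.
  evalMon-exponents : ∀ {m} ys (a : Fin m → Carrier) → evalMon K (exponents ys) a ≈ prod a ys
  evalMon-exponents []       a = evalMon-zero a
  evalMon-exponents (y ∷ ys) a = trans (reflexive (≡.cong (λ v → evalMon K v a) (tabulate-cong count-∷)))
    (trans (evalMon-+ _ (λ X → count X ys) a) (*-cong (evalMon-indicator y a) (evalMon-exponents ys a)))
    where
    count-∷ : ∀ X → count X (y ∷ ys) ≡ (if does (y ≟ᶠ X) then 1 else 0) +ℕ count X ys
    count-∷ X with does (y ≟ᶠ X)
    ... | true  = ≡.refl
    ... | false = ≡.refl

  evalMon-expand : ∀ (m : Monomial K n) a → evalMon K m a ≈ prod a (expand m)
  evalMon-expand m a = trans (reflexive (≡.cong (λ v → evalMon K v a) (≡.sym (exponents-expand m))))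
                             (evalMon-exponents (expand m) a)

  evalMon-mono : ∀ {m} (v : Vec ℕ m) {a b} → (∀ X → a X ≤ b X) → evalMon K v a ≤ evalMon K v b
  evalMon-mono []      a≤b = ≤-refl
  evalMon-mono (k ∷ v) a≤b = *-mono (^-mono (a≤b fzero) k) (evalMon-mono v (a≤b ∘ fsuc))

  evalPoly-mono : ∀ (P : Poly K n) {a b} → a ≼ b → evalPoly K P a ≤ evalPoly K P b
  evalPoly-mono []            a≼b = ≤-refl
  evalPoly-mono ((k , m) ∷ P) a≼b = +-mono (*-monoʳ k (evalMon-mono m a≼b)) (evalPoly-mono P a≼b)

  F-mono : ∀ {a b} → a ≼ b → ⟦ a ⟧ ≼ ⟦ b ⟧
  F-mono a≼b X = evalPoly-mono (E X) a≼b

  term≤evalPoly : ∀ {P : Poly K n} {t} a → t ∈ P → proj₁ t * evalMon K (proj₂ t) a ≤ evalPoly K P a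
  term≤evalPoly a (here ≡.refl) = x≤x+y _ _
  term≤evalPoly a (there t∈P)   = ≤-trans (term≤evalPoly a t∈P) (y≤x+y _ _)

  ⨅ω-^ : ∀ {f} → Descending f → ∀ k → ⨅ω (λ j → f j ^ k) ≤ ⨅ω f ^ k
  ⨅ω-^ df zero    = ≤1 _
  ⨅ω-^ df (suc k) = ≤-trans (⨅ω-* df (λ i≤j → ^-mono (df i≤j) k)) (*-monoʳ _ (⨅ω-^ df k))

  ⨆ω-^ : ∀ {f} → Ascending f → ∀ k → ⨆ω f ^ k ≤ ⨆ω (λ j → f j ^ k)
  ⨆ω-^ af zero    = ⨆ω-upper _ 0
  ⨆ω-^ af (suc k) = ≤-trans (*-monoʳ _ (⨆ω-^ af k)) (⨆ω-* af (λ i≤j → ^-mono (af i≤j) k))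

  ⨅ω-evalMon : ∀ {m} (v : Vec ℕ m) {a : ℕ → Fin m → Carrier} → (∀ X → Descending (λ j → a j X)) →
               ⨅ω (λ j → evalMon K v (a j)) ≤ evalMon K v (λ X → ⨅ω (λ j → a j X))
  ⨅ω-evalMon []      da = ≤1 _
  ⨅ω-evalMon (k ∷ v) da = ≤-trans
    (⨅ω-* (λ i≤j → ^-mono (da fzero i≤j) k) (λ i≤j → evalMon-mono v (λ X → da (fsuc X) i≤j)))
    (*-mono (⨅ω-^ (da fzero) k) (⨅ω-evalMon v (da ∘ fsuc)))

  ⨆ω-evalMon : ∀ {m} (v : Vec ℕ m) {a : ℕ → Fin m → Carrier} → (∀ X → Ascending (λ j → a j X)) →
               evalMon K v (λ X → ⨆ω (λ j → a j X)) ≤ ⨆ω (λ j → evalMon K v (a j))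
  ⨆ω-evalMon []      aa = ⨆ω-upper _ 0
  ⨆ω-evalMon (k ∷ v) aa = ≤-trans
    (*-mono (⨆ω-^ (aa fzero) k) (⨆ω-evalMon v (aa ∘ fsuc)))
    (⨆ω-* (λ i≤j → ^-mono (aa fzero i≤j) k) (λ i≤j → evalMon-mono v (λ X → aa (fsuc X) i≤j)))

  ⨅ω-evalPoly : ∀ (P : Poly K n) {a : ℕ → Valuation} → (∀ X → Descending (λ j → a j X)) →
                ⨅ω (λ j → evalPoly K P (a j)) ≤ evalPoly K P (λ X → ⨅ω (λ j → a j X))
  ⨅ω-evalPoly []            da = ⨅ω-lower _ 0
  ⨅ω-evalPoly ((k , m) ∷ P) da = ≤-trans
    (⨅ω-+ (λ i≤j → *-monoʳ k (dm i≤j)) (λ i≤j → evalPoly-mono P (λ X → da X i≤j)))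
    (+-mono (≤-trans (≤-reflexive (sym (*-⨅ _ (descending-chain dm) k))) (*-monoʳ k (⨅ω-evalMon m da)))
            (⨅ω-evalPoly P da))
    where
    dm : Descending _
    dm i≤j = evalMon-mono m (λ X → da X i≤j)

  -- For a supremum the outer sum takes no diagonal argument: it is a join, so each summand is
  -- bounded separately. Only the powers and products inside a monomial need the diagonal.
  ⨆ω-evalPoly : ∀ (P : Poly K n) {a : ℕ → Valuation} → (∀ X → Ascending (λ j → a j X)) →
                evalPoly K P (λ X → ⨆ω (λ j → a j X)) ≤ ⨆ω (λ j → evalPoly K P (a j))
  ⨆ω-evalPoly []            aa = 0≤ _
  ⨆ω-evalPoly ((k , m) ∷ P) {a} aa = +-lub
    (begin
      k * evalMon K m (λ X → ⨆ω (λ j → a j X))   ≤⟨ *-monoʳ k (⨆ω-evalMon m aa) ⟩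
      k * ⨆ω (λ j → evalMon K m (a j))           ≈⟨ *-⨆ _ (ascending-chain λ i≤j → evalMon-mono m (λ X → aa X i≤j)) k ⟩
      ⨆ω (λ j → k * evalMon K m (a j))           ≤⟨ ⨆ω-least _ (λ j → ≤-trans (x≤x+y _ _) (⨆ω-upper _ j)) ⟩
      ⨆ω (λ j → evalPoly K ((k , m) ∷ P) (a j))  ∎)
    (≤-trans (⨆ω-evalPoly P aa) (⨆ω-least _ (λ j → ≤-trans (y≤x+y _ _) (⨆ω-upper _ j))))

  iterate : Valuation → ℕ → Valuation
  iterate a zero    = a
  iterate a (suc k) = ⟦ iterate a k ⟧

  bottom top : Valuation
  bottom _ = 0#
  top    _ = 1#

  iterate-ascending : ∀ X → Ascending (λ k → iterate bottom k X)
  iterate-ascending X j≤k = go j≤k X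
    where
    go : ∀ {j k} → j ≤ℕ k → iterate bottom j ≼ iterate bottom k
    go z≤n       X = 0≤ _
    go (s≤s j≤k) = F-mono (go j≤k)

  iterate-descending : ∀ X → Descending (λ k → iterate top k X)
  iterate-descending X j≤k = go j≤k X
    where
    go : ∀ {j k} → j ≤ℕ k → iterate top k ≼ iterate top j
    go z≤n       X = ≤1 _
    go (s≤s j≤k) = F-mono (go j≤k)

  kleene-lfp kleene-gfp : Valuation
  kleene-lfp X = ⨆ω (λ k → iterate bottom k X)
  kleene-gfp X = ⨅ω (λ k → iterate top k X)

  kleene-lfp-fixed : IsFixedPoint K E kleene-lfp
  kleene-lfp-fixed X = ≤-antisym
    (≤-trans (⨆ω-evalPoly (E X) iterate-ascending) (⨆ω-least _ (λ k → ⨆ω-upper _ (suc k))))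
    (⨆ω-least _ λ k → ≤-trans (iterate-ascending X (ℕ.n≤1+n k)) (F-mono (λ Y → ⨆ω-upper _ k) X))

  kleene-gfp-fixed : IsFixedPoint K E kleene-gfp
  kleene-gfp-fixed X = ≤-antisym
    (⨅ω-greatest _ λ k → ≤-trans (F-mono (λ Y → ⨅ω-lower _ k) X) (iterate-descending X (ℕ.n≤1+n k)))
    (≤-trans (⨅ω-greatest _ (λ k → ⨅ω-lower _ (suc k))) (⨅ω-evalPoly (E X) iterate-descending))

  kleene-lfp-least : ∀ b → IsFixedPoint K E b → kleene-lfp ≼ b
  kleene-lfp-least b fixed X = ⨆ω-least _ (λ k → go k X)
    where
    go : ∀ k → iterate bottom k ≼ b
    go zero    X = 0≤ _
    go (suc k) X = ≤-trans (F-mono (go k) X) (≤-reflexive (fixed X))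

  fixed-resp : ∀ {a b} → a ≼ b → b ≼ a → IsFixedPoint K E a → IsFixedPoint K E b
  fixed-resp a≼b b≼a fixed X = ≤-antisym
    (≤-trans (F-mono b≼a X) (≤-trans (≤-reflexive (fixed X)) (a≼b X)))
    (≤-trans (b≼a X) (≤-trans (≤-reflexive (sym (fixed X))) (F-mono a≼b X)))

  -- Truncating a derivation tree at finite depth

  longest : List (List ℕ) → ℕ
  longest = foldr (λ p → length p ⊔ℕ_) 0

  length≤longest : ∀ {p xs} → p ∈ xs → length p ≤ℕ longest xs
  length≤longest (here ≡.refl)              = ℕ.m≤m⊔n _ _
  length≤longest {xs = q ∷ xs} (there p∈xs) = ℕ.≤-trans (length≤longest p∈xs) (ℕ.m≤n⊔m (length q) _)

  module Truncation (T : Tree K n) where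
    open Tree T

    -- `k` counts levels including that of `p`, so `nodes k []` consists of the nodes whose paths
    -- are shorter than `k`. Since paths store the latest step first, everything below `p` ends in
    -- `p`.
    nodes descendants : ℕ → List ℕ → List (List ℕ)
    nodes zero    p = []
    nodes (suc k) p = p ∷ descendants k p
    descendants k p = concatMap (λ i → nodes k (i ∷ p)) (upTo (arity p))

    ∈-descendants⁻ : ∀ k {p q} → q ∈ descendants k p → ∃ λ i → i <ℕ arity p × q ∈ nodes k (i ∷ p)
    ∈-descendants⁻ k {p} q∈ with find (∈-concatMap⁻ (λ i → nodes k (i ∷ p)) {xs = upTo (arity p)} q∈)
    ... | i , i∈ , q∈′ = i , ∈-upTo⁻ i∈ , q∈′

    ∈-descendants⁺ : ∀ k {p q i} → i <ℕ arity p → q ∈ nodes k (i ∷ p) → q ∈ descendants k p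
    ∈-descendants⁺ k i< q∈ = ∈-concatMap⁺ (λ i → nodes k (i ∷ _)) (lose (∈-upTo⁺ i<) q∈)

    nodes-Node : ∀ k {p q} → Node K T p → q ∈ nodes k p → Node K T q
    nodes-Node (suc k) Np (here ≡.refl) = Np
    nodes-Node (suc k) Np (there q∈) with ∈-descendants⁻ k q∈
    ... | i , i< , q∈′ = nodes-Node k (child Np i<) q∈′

    nodes-suffix : ∀ k {p q} → q ∈ nodes k p → ∃ λ s → q ≡ s ++ p
    nodes-suffix (suc k)     (here ≡.refl) = [] , ≡.refl
    nodes-suffix (suc k) {p} (there q∈) with ∈-descendants⁻ k q∈
    ... | i , _ , q∈′ with nodes-suffix k q∈′
    ...   | s , ≡.refl = s ∷ʳ i , ≡.sym (∷ʳ-++ s i p)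

    -- The step taken from `p` is the letter directly in front of the suffix `p`, and a path has
    -- only one such letter.
    siblings-disjoint : ∀ k {p q i j} → q ∈ nodes k (i ∷ p) → q ∈ nodes k (j ∷ p) → i ≡ j
    siblings-disjoint k {p} {q} {i} {j} q∈i q∈j with nodes-suffix k q∈i | nodes-suffix k q∈j
    ... | s , eq | s′ , eq′ = ∷ʳ-injectiveʳ s s′ (++-cancelʳ p (s ∷ʳ i) (s′ ∷ʳ j)
      (≡.trans (∷ʳ-++ s i p) (≡.trans (≡.sym eq) (≡.trans eq′ (≡.sym (∷ʳ-++ s′ j p))))))

    nodes-unique : ∀ k p → Unique (nodes k p)
    nodes-unique zero    p = []
    nodes-unique (suc k) p =
      All.tabulate (λ { q∈ ≡.refl → p∉ q∈ })
      ∷ Unique.concat⁺ (All.map⁺ (All.tabulate (λ {i} _ → nodes-unique k (i ∷ p))))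
          (AllPairs.map⁺ (AllPairs.map disjoint (Unique.upTo⁺ (arity p))))
      where
      disjoint : ∀ {i j} → i ≢ j → Disjoint (nodes k (i ∷ p)) (nodes k (j ∷ p))
      disjoint i≢j (q∈i , q∈j) = i≢j (siblings-disjoint k q∈i q∈j)
      p∉ : ¬ (p ∈ descendants k p)
      p∉ p∈ with ∈-descendants⁻ k p∈
      ... | i , _ , p∈′ with nodes-suffix k p∈′
      ...   | s , eq = ℕ.m≢1+n+m (length p)
        (≡.trans (≡.cong length eq) (≡.trans (length-++ s) (ℕ.+-suc (length s) (length p))))

    -- The strict bound says that the child lies fewer than `k` levels below `p`, stated without
    -- subtraction. With a single level it is contradictory, as `q` is then `p` itself.
    nodes-child : ∀ k {p q i} → q ∈ nodes k p → suc (length q) <ℕ k +ℕ length p → i <ℕ arity q →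
                  (i ∷ q) ∈ nodes k p
    nodes-child (suc zero)    (here ≡.refl) short _ = ⊥-elim (ℕ.<-irrefl ≡.refl short)
    nodes-child (suc (suc k)) (here ≡.refl) short i< = there (∈-descendants⁺ (suc k) i< (here ≡.refl))
    nodes-child (suc k) {p} {q} (there q∈) short i< with ∈-descendants⁻ k q∈
    ... | j , j< , q∈′ = there (∈-descendants⁺ k j<
      (nodes-child k q∈′ (≡.subst (suc (length q) <ℕ_) (≡.sym (ℕ.+-suc k (length p))) short) i<))

    Node⇒∈nodes : ∀ k {p} → Node K T p → length p <ℕ k → p ∈ nodes k []
    Node⇒∈nodes (suc k) root          _     = here ≡.refl
    Node⇒∈nodes k {_ ∷ p} (child Np i<) short = nodes-child k (Node⇒∈nodes k Np (ℕ.<⇒≤ short))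
      (≡.subst (suc (length p) <ℕ_) (≡.sym (ℕ.+-identityʳ k)) short) i<

    truncated : ℕ → List ℕ → Carrier
    truncated k p = prod yd (nodes k p)

    truncated-suc : ∀ k p → truncated (suc k) p ≈ yd p * prod (λ i → truncated k (i ∷ p)) (upTo (arity p))
    truncated-suc k p = *-congˡ (prod-concatMap yd (λ i → nodes k (i ∷ p)) (upTo (arity p)))

    ydT≤truncated : ∀ k → ydT K FC T ≤ truncated k []
    ydT≤truncated k = ⨅-lower _ (lift (nodes k [] , nodes-unique k [] , All.tabulate (nodes-Node k root)))

    -- Truncations are cofinal among the finite subproducts: a finite set of nodes lies within the
    -- first `k` levels as soon as `k` exceeds its longest path, hence the `suc`.
    ydT-greatest : ∀ {x} → (∀ k → x ≤ truncated k []) → x ≤ ydT K FC T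
    ydT-greatest x≤ = ⨅-greatest _ _ λ (lift (xs , xs! , Nxs)) →
      ≤-trans (x≤ (suc (longest xs))) (prod-antitone yd xs! (λ p∈ →
        Node⇒∈nodes _ (All.lookup Nxs p∈) (s≤s (length≤longest p∈))))

    mon≡exponents : ∀ p → mon K T p ≡ exponents (map (λ i → var (i ∷ p)) (upTo (arity p)))
    mon≡exponents p = tabulate-cong (λ X → length-filter-map (λ i → var (i ∷ p)) X (upTo (arity p)))

    evalMon-mon : ∀ p a → evalMon K (mon K T p) a ≈ prod (λ i → a (var (i ∷ p))) (upTo (arity p))
    evalMon-mon p a = trans (reflexive (≡.cong (λ v → evalMon K v a) (mon≡exponents p)))
      (trans (evalMon-exponents (map (λ i → var (i ∷ p)) (upTo (arity p))) a)
             (reflexive (prod-map a (λ i → var (i ∷ p)) (upTo (arity p)))))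

    module _ (compatible : Compatible K T E) where

      -- Taking a = 0 makes base vacuous once d exceeds the height of T; taking a = 1 allows d = 0.
      truncated≤iterate : ∀ a d → (∀ p → Node K T p → d ≤ℕ length p → 1# ≤ a (var p)) →
                          ∀ k p → Node K T p → d ≤ℕ k +ℕ length p → truncated k p ≤ iterate a k (var p)
      truncated≤iterate a d base zero    p Np d≤ = base p Np d≤
      truncated≤iterate a d base (suc k) p Np d≤ with find (compatible p Np)
      ... | (c , m) , t∈ , c≈yd , m≡mon = begin
        truncated (suc k) p
          ≈⟨ truncated-suc k p ⟩
        yd p * prod (λ i → truncated k (i ∷ p)) (upTo (arity p))
          ≤⟨ *-monoʳ _ (prod-mono (upTo (arity p)) (λ {i} i∈ →
               truncated≤iterate a d base k (i ∷ p) (child Np (∈-upTo⁻ i∈))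
                 (≡.subst (d ≤ℕ_) (≡.sym (ℕ.+-suc k (length p))) d≤))) ⟩
        yd p * prod (λ i → iterate a k (var (i ∷ p))) (upTo (arity p))
          ≈⟨ *-cong (sym c≈yd) (sym (evalMon-mon p (iterate a k))) ⟩
        c * evalMon K (mon K T p) (iterate a k)
          ≈⟨ *-congˡ (reflexive (≡.cong (λ v → evalMon K v (iterate a k)) (≡.sym m≡mon))) ⟩
        c * evalMon K m (iterate a k)
          ≤⟨ term≤evalPoly (iterate a k) t∈ ⟩
        iterate a (suc k) (var p) ∎

      ydT≤kleene-gfp : ydT K FC T ≤ kleene-gfp (var [])
      ydT≤kleene-gfp = ⨅ω-greatest _ λ k → ≤-trans (ydT≤truncated k)
        (truncated≤iterate top 0 (λ _ _ _ → ≤-refl) k [] root z≤n)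

      ydT≤kleene-lfp : Finite K T → ydT K FC T ≤ kleene-lfp (var [])
      ydT≤kleene-lfp (xs , complete) = ≤-trans (ydT≤truncated d) (≤-trans
        (truncated≤iterate bottom d (λ p Np d≤ → ⊥-elim (ℕ.<⇒≱ (s≤s (length≤longest (complete p Np))) d≤))
          d [] root (ℕ.m≤m+n d 0))
        (⨆ω-upper _ d))
        where
        d = suc (longest xs)

  sumAllTrees≼kleene-gfp : sumAllTrees K FC E ≼ kleene-gfp
  sumAllTrees≼kleene-gfp X = ⨆-least _ _ λ { (T , compatible , ≡.refl) →
    Truncation.ydT≤kleene-gfp T compatible }

  sumFiniteTrees≼kleene-lfp : sumFiniteTrees K FC E ≼ kleene-lfp
  sumFiniteTrees≼kleene-lfp X = ⨆-least _ _ λ { (T , (compatible , ≡.refl) , finite) →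
    Truncation.ydT≤kleene-lfp T compatible finite }

  -- Expanding polynomials into rules, and terms for rational trees

  Rule : Fin n → Set c
  Rule X = Σ (Carrier × Monomial K n) (_∈ E X)

  coeff : ∀ {X} → Rule X → Carrier
  coeff ((k , _) , _) = k

  rhs : ∀ {X} → Rule X → List (Fin n)
  rhs ((_ , m) , _) = expand m

  private variable
    X : Fin n
    Ys Γ Δ : List (Fin n)

  prodAll : ∀ {i} {I : Fin n → Set i} → (∀ {Y} → I Y → Carrier) → All I Ys → Carrier
  prodAll v []       = 1#
  prodAll v (i ∷ is) = v i * prodAll v is

  cover-prod : ∀ {i} {I : Fin n → Set i} (v : ∀ {Y} → I Y → Carrier) {a} →
               (∀ Y → Cover (v {Y}) (a Y)) → ∀ Ys → Cover (prodAll {Ys = Ys} v) (prod a Ys)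
  cover-prod v covers []       = cover-single _ [] ≤-refl
  cover-prod v covers (Y ∷ Ys) =
    cover-map (λ (i , is) → i ∷ is) (λ _ → ≤-refl) (cover-* (covers Y) (cover-prod v covers Ys))

  -- Multiplying out the polynomial, each summand of the result picks one rule and one index per
  -- child, which is one level of a derivation tree. Working with `expand m` instead of powers lets
  -- equal variables choose different indices.
  cover-F : ∀ {i} {I : Fin n → Set i} (v : ∀ {Y} → I Y → Carrier) {a} → (∀ Y → Cover (v {Y}) (a Y)) →
            ∀ X → Cover {A = Σ (Rule X) λ r → All I (rhs r)} (λ (r , is) → coeff r * prodAll v is) (⟦ a ⟧ X)
  cover-F {I = I} v {a} covers X = go (E X) id
    where
    -- The inclusion remembers that the remaining list is still part of `E X`, so that its entries
    -- give rules.
    go : ∀ P → (∀ {t} → t ∈ P → t ∈ E X) →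
         Cover {A = Σ (Rule X) λ r → All I (rhs r)} (λ (r , is) → coeff r * prodAll v is) (evalPoly K P a)
    go []            P⊆ = [] , ≤-refl
    go ((k , m) ∷ P) P⊆ = cover-+ term (go P (P⊆ ∘ there))
      where
      term : Cover {A = Σ (Rule X) λ r → All I (rhs r)} (λ (r , is) → coeff r * prodAll v is) (k * evalMon K m a)
      term with cover-* {v = λ (_ : Carrier) → k} {x = k} (cover-single _ k ≤-refl) (cover-prod v covers (expand m))
      ... | cov = cover-map (λ (_ , is) → ((k , m) , P⊆ (here ≡.refl)) , is) (λ _ → ≤-refl)
        (proj₁ cov , ≤-trans (≤-reflexive (*-congˡ (evalMon-expand m a))) (proj₂ cov))

  -- A term denotes a rational derivation tree: each back reference to X ∈ Γ stands for the whole
  -- subtree at the enclosing loop that binds X.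
  data Term (Γ : List (Fin n)) : Fin n → Set c where
    ref   : X ∈ Γ → Term Γ X
    plain : (r : Rule X) → All (Term Γ) (rhs r) → Term Γ X
    loop  : (r : Rule X) → All (Term (X ∷ Γ)) (rhs r) → Term Γ X

  -- A reference weighs `1#` because the copies of the loop body that it calls up are paid for by
  -- the infinite power at the loop.
  weight  : Term Γ X → Carrier
  weights : All (Term Γ) Ys → Carrier
  weight (ref _)      = 1#
  weight (plain r ts) = coeff r * weights ts
  weight (loop r ts)  = (coeff r * weights ts) ^∞
  weights []       = 1#
  weights (t ∷ ts) = weight t * weights ts

  rename  : (∀ {Z} → Z ∈ Γ → Z ∈ Δ) → Term Γ X → Term Δ X
  renames : (∀ {Z} → Z ∈ Γ → Z ∈ Δ) → All (Term Γ) Ys → All (Term Δ) Ys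
  lift-∈  : (∀ {Z} → Z ∈ Γ → Z ∈ Δ) → ∀ {Z} → Z ∈ X ∷ Γ → Z ∈ X ∷ Δ
  lift-∈ Γ⊆Δ (here eq)  = here eq
  lift-∈ Γ⊆Δ (there z∈) = there (Γ⊆Δ z∈)
  rename Γ⊆Δ (ref x∈)     = ref (Γ⊆Δ x∈)
  rename Γ⊆Δ (plain r ts) = plain r (renames Γ⊆Δ ts)
  rename Γ⊆Δ (loop r ts)  = loop r (renames (lift-∈ Γ⊆Δ) ts)
  renames Γ⊆Δ []       = []
  renames Γ⊆Δ (t ∷ ts) = rename Γ⊆Δ t ∷ renames Γ⊆Δ ts

  weight-rename  : (Γ⊆Δ : ∀ {Z} → Z ∈ Γ → Z ∈ Δ) (t : Term Γ X) → weight (rename Γ⊆Δ t) ≡ weight t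
  weights-rename : (Γ⊆Δ : ∀ {Z} → Z ∈ Γ → Z ∈ Δ) (ts : All (Term Γ) Ys) →
                   weights (renames Γ⊆Δ ts) ≡ weights ts
  weight-rename Γ⊆Δ (ref x∈)     = ≡.refl
  weight-rename Γ⊆Δ (plain r ts) = ≡.cong (coeff r *_) (weights-rename Γ⊆Δ ts)
  weight-rename Γ⊆Δ (loop r ts)  = ≡.cong (λ w → (coeff r * w) ^∞) (weights-rename (lift-∈ Γ⊆Δ) ts)
  weights-rename Γ⊆Δ []       = ≡.refl
  weights-rename Γ⊆Δ (t ∷ ts) = ≡.cong₂ _*_ (weight-rename Γ⊆Δ t) (weights-rename Γ⊆Δ ts)

  -- Unfolding terms into derivation trees

  data Env : List (Fin n) → Set c where
    []  : Env []
    _∷_ : Term Γ X → Env Γ → Env (X ∷ Γ)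

  record State (X : Fin n) : Set c where
    constructor state
    field
      rule     : Rule X
      {scope}  : List (Fin n)
      subterms : All (Term scope) (rhs rule)
      env      : Env scope

  -- Resolves references until a rule is exposed. Every lookup passes to a shorter environment, so
  -- this stops; a loop pushes itself, so that references in its body find it again.
  enter : Term Γ X → Env Γ → State X
  enter (plain r ts)         ρ       = state r ts ρ
  enter (loop r ts)          ρ       = state r ts (loop r ts ∷ ρ)
  enter (ref (here ≡.refl))  (t ∷ ρ) = enter t ρ
  enter (ref (there x∈))     (t ∷ ρ) = enter (ref x∈) ρ

  -- A bound term may be entered arbitrarily often, so its weight is stored as an infinite power.
  -- This makes the whole environment idempotent and shareable by all children.
  envWeight : Env Γ → Carrier
  envWeight []      = 1#
  envWeight (t ∷ ρ) = weight t ^∞ * envWeight ρ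

  envWeight-idem : (ρ : Env Γ) → envWeight ρ ≤ envWeight ρ * envWeight ρ
  envWeight-idem []      = ≤-reflexive (sym (*-identityˡ _))
  envWeight-idem (t ∷ ρ) = ≤-trans (*-mono (^∞-idem (weight t)) (envWeight-idem ρ))
                                   (≤-reflexive (*-interchange _ _ _ _))

  stateWeight : State X → Carrier
  stateWeight (state r ts ρ) = coeff r * (weights ts * envWeight ρ)

  -- A loop spends one copy of its body on the node and keeps the rest for the environment that now
  -- contains it. A reference has no weight of its own and takes one copy of the bound term from the
  -- environment.
  weight≤stateWeight : (t : Term Γ X) (ρ : Env Γ) → weight t * envWeight ρ ≤ stateWeight (enter t ρ)
  weight≤stateWeight (plain r ts) ρ = ≤-reflexive (*-assoc _ _ _)
  weight≤stateWeight (loop r ts)  ρ = begin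
    q ^∞ * envWeight ρ                                         ≤⟨ *-mono (^∞-unfold q) ≤-refl ⟩
    -- The new environment entry weighs `weight (loop r ts) ^∞`, a doubly infinite power;
    -- idempotence of `q ^∞` provides it.
    (q * q ^∞) * envWeight ρ                                   ≤⟨ *-mono (*-monoʳ q (idem⇒≤^∞ (^∞-idem q))) ≤-refl ⟩
    (q * q ^∞ ^∞) * envWeight ρ                                ≈⟨ *-assoc _ _ _ ⟩
    (coeff r * weights ts) * (q ^∞ ^∞ * envWeight ρ)           ≈⟨ *-assoc _ _ _ ⟩
    stateWeight (enter (loop r ts) ρ)                          ∎
    where q = coeff r * weights ts
  weight≤stateWeight (ref (here ≡.refl)) (t ∷ ρ) =
    ≤-trans (x*y≤y _ _) (≤-trans (*-mono (^∞≤ (weight t)) ≤-refl) (weight≤stateWeight t ρ))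
  weight≤stateWeight (ref (there x∈)) (t ∷ ρ) =
    ≤-trans (*-monoʳ 1# (x*y≤y _ _)) (weight≤stateWeight (ref x∈) ρ)

  SomeState : Set c
  SomeState = Σ (Fin n) State

  enterAll : All (Term Γ) Ys → Env Γ → List SomeState
  enterAll []       ρ = []
  enterAll (t ∷ ts) ρ = (_ , enter t ρ) ∷ enterAll ts ρ

  successors : SomeState → List SomeState
  successors (_ , state r ts ρ) = enterAll ts ρ

  map-proj₁-enterAll : (ts : All (Term Γ) Ys) (ρ : Env Γ) → map proj₁ (enterAll ts ρ) ≡ Ys
  map-proj₁-enterAll []       ρ = ≡.refl
  map-proj₁-enterAll (t ∷ ts) ρ = ≡.cong (_ ∷_) (map-proj₁-enterAll ts ρ)

  -- Idempotence of `envWeight` hands every child its own copy of the environment.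
  weights≤enterAll : (ts : All (Term Γ) Ys) (ρ : Env Γ) →
                     weights ts * envWeight ρ ≤ prod (stateWeight ∘ proj₂) (enterAll ts ρ)
  weights≤enterAll []       ρ = ≤1 _
  weights≤enterAll (t ∷ ts) ρ = begin
    (weight t * weights ts) * envWeight ρ                   ≤⟨ *-monoʳ _ (envWeight-idem ρ) ⟩
    (weight t * weights ts) * (envWeight ρ * envWeight ρ)   ≈⟨ *-interchange _ _ _ _ ⟩
    (weight t * envWeight ρ) * (weights ts * envWeight ρ)   ≤⟨ *-mono (weight≤stateWeight t ρ) (weights≤enterAll ts ρ) ⟩
    prod (stateWeight ∘ proj₂) (enterAll (t ∷ ts) ρ)        ∎

  -- The index bounds the number of levels of the unfolding; it starts at one because even a leaf
  -- occupies a level.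
  data Halts : ℕ → SomeState → Set c where
    halts : ∀ {k s} → (∀ {s′} → s′ ∈ successors s → Halts k s′) → Halts (suc k) s

  module Unfolding (start : SomeState) where

    walk : List ℕ → SomeState
    walk []      = start
    -- The default `walk p` only makes the function total: a path with an index out of range is not
    -- a node.
    walk (i ∷ p) = nth (walk p) (successors (walk p)) i

    unfold : Tree K n
    unfold = record
      { arity = λ p → length (successors (walk p))
      ; var   = λ p → proj₁ (walk p)
      ; yd    = λ p → coeff (State.rule (proj₂ (walk p)))
      }

    open Truncation unfold

    map-walk : ∀ p → map (λ i → walk (i ∷ p)) (upTo (length (successors (walk p)))) ≡ successors (walk p)
    map-walk p = map-nth-upTo (walk p) (successors (walk p))

    mon-unfold : ∀ p → mon K unfold p ≡ proj₂ (proj₁ (State.rule (proj₂ (walk p))))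
    mon-unfold p = ≡.trans (mon≡exponents p) (≡.trans (≡.cong exponents children) (exponents-expand _))
      where
      children : map (λ i → proj₁ (walk (i ∷ p))) (upTo (length (successors (walk p)))) ≡
                 rhs (State.rule (proj₂ (walk p)))
      children = ≡.trans (map-∘ (upTo (length (successors (walk p))))) (≡.trans
        (≡.cong (map proj₁) (map-walk p))
        (map-proj₁-enterAll (State.subterms (proj₂ (walk p))) (State.env (proj₂ (walk p)))))

    unfolding-compatible : Compatible K unfold E
    unfolding-compatible p _ =
      lose (proj₂ (State.rule (proj₂ (walk p)))) (refl , ≡.sym (mon-unfold p))

    -- The weight of a state pays for its coefficient and for the weights of its successors. After
    -- `k` levels whatever weight is left is bounded by `1#`.
    stateWeight≤truncated : ∀ k p → stateWeight (proj₂ (walk p)) ≤ truncated k p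
    stateWeight≤truncated zero    p = ≤1 _
    stateWeight≤truncated (suc k) p = begin
      stateWeight s                                                       ≤⟨ *-monoʳ _ (weights≤enterAll (State.subterms s) (State.env s)) ⟩
      coeff (State.rule s) * prod (stateWeight ∘ proj₂) (successors (walk p))
        ≈⟨ *-congˡ (reflexive (≡.trans (≡.cong (prod _) (≡.sym (map-walk p))) (prod-map _ _ indices))) ⟩
      coeff (State.rule s) * prod (λ i → stateWeight (proj₂ (walk (i ∷ p)))) indices
        ≤⟨ *-monoʳ _ (prod-mono indices (λ {i} _ → stateWeight≤truncated k (i ∷ p))) ⟩
      coeff (State.rule s) * prod (λ i → truncated k (i ∷ p)) indices
        ≈⟨ truncated-suc k p ⟨
      truncated (suc k) p ∎
      where
      s = proj₂ (walk p)
      indices = upTo (length (successors (walk p)))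

    stateWeight≤ydT : stateWeight (proj₂ start) ≤ ydT K FC unfold
    stateWeight≤ydT = ydT-greatest (λ k → stateWeight≤truncated k [])

    -- Levels left plus depth stay constant along a path. As at least one level is left at every
    -- node, its path is shorter than `k`.
    Halts-walk : ∀ {k p} → Halts k start → Node K unfold p →
                 ∃ λ j → Halts j (walk p) × j +ℕ length p ≡ k
    Halts-walk {k} h root = k , h , ℕ.+-identityʳ k
    Halts-walk {p = i ∷ p} h (child Np i<) with Halts-walk h Np
    ... | suc j , halts hs , eq = j , hs (nth-∈ (walk p) i<) , ≡.trans (ℕ.+-suc j (length p)) eq

    unfolding-finite : ∀ {k} → Halts k start → Finite K unfold
    unfolding-finite {k} h = nodes k [] , λ p Np → Node⇒∈nodes k Np (short p (Halts-walk h Np))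
      where
      short : ∀ p → (∃ λ j → Halts j (walk p) × j +ℕ length p ≡ k) → length p <ℕ k
      short p (suc j , _ , ≡.refl) = s≤s (ℕ.m≤n+m _ j)

  open Unfolding

  close : Term [] X → SomeState
  close t = _ , enter t []

  weight≤ydT : (t : Term [] X) → weight t ≤ ydT K FC (unfold (close t))
  weight≤ydT t = ≤-trans (≤-reflexive (sym (*-identityʳ _)))
    (≤-trans (weight≤stateWeight t []) (stateWeight≤ydT (close t)))

  -- Finite trees and the least fixed point

  FiniteTerm : ℕ → Fin n → Set c
  FiniteTerm k X = Σ (Term [] X) λ t → Halts k (close t)

  -- Each application of the operator puts one `plain` rule on top of the terms found so far, hence
  -- one more level. The iteration starts from `0#`, the empty sum, so no open leaves remain.
  cover-iterate : ∀ k X → Cover (λ (t : FiniteTerm k X) → weight (proj₁ t)) (iterate bottom k X)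
  cover-iterate zero    X = [] , ≤-refl
  cover-iterate (suc k) X =
    cover-map (λ (r , is) → plain r (terms is) , halts (terms-halt is))
              (λ (r , is) → ≤-reflexive (*-congˡ (reflexive (weights-terms is))))
              (cover-F (λ t → weight (proj₁ t)) (cover-iterate k) X)
    where
    terms : All (FiniteTerm k) Ys → All (Term []) Ys
    terms = All.map proj₁

    weights-terms : (is : All (FiniteTerm k) Ys) → prodAll (λ t → weight (proj₁ t)) is ≡ weights (terms is)
    weights-terms []       = ≡.refl
    weights-terms (i ∷ is) = ≡.cong (weight (proj₁ i) *_) (weights-terms is)

    terms-halt : (is : All (FiniteTerm k) Ys) → ∀ {s} → s ∈ enterAll (terms is) [] → Halts k s
    terms-halt ((_ , h) ∷ is) (here ≡.refl) = h
    terms-halt (_ ∷ is)       (there s∈)    = terms-halt is s∈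

  kleene-lfp≼sumFiniteTrees : kleene-lfp ≼ sumFiniteTrees K FC E
  kleene-lfp≼sumFiniteTrees X = ⨆ω-least _ λ k →
    ≤-trans (proj₂ (cover-iterate k X)) (sum-least _ (proj₁ (cover-iterate k X)) λ (t , h) →
      ≤-trans (weight≤ydT t) (⨆-upper _ (unfold (close t) ,
        (unfolding-compatible (close t) , ≡.refl) , unfolding-finite (close t) h)))

  -- Eliminating the variables of a post-fixed point

  module PostFixedPoint (b : Valuation) (b≼Fb : b ≼ ⟦ b ⟧) where

    -- `V` is the set of variables already eliminated. The references still open are outside `V` and
    -- enter `value` as factors taken from `b`.
    record OpenTerm (V : Subset n) (X : Fin n) : Set c where
      constructor openTerm
      field
        {refs} : List (Fin n)
        fresh  : All (_∉ˢ V) refs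
        term   : Term refs X

    record OpenBody (V : Subset n) (Ys : List (Fin n)) : Set c where
      constructor openBody
      field
        {refs} : List (Fin n)
        fresh  : All (_∉ˢ V) refs
        terms  : All (Term refs) Ys

    private variable
      V : Subset n

    value : OpenTerm V X → Carrier
    value (openTerm {refs} _ t) = weight t * prod b refs

    bodyValue : OpenBody V Ys → Carrier
    bodyValue (openBody {refs} _ ts) = weights ts * prod b refs

    OpenRule : Subset n → Fin n → Set c
    OpenRule V X = Σ (Rule X) λ r → OpenBody V (rhs r)

    ruleValue : OpenRule V X → Carrier
    ruleValue (r , body) = coeff r * bodyValue body

    -- The reference lists of the children are concatenated with duplicates kept, so that their
    -- products under `b` simply multiply.
    join : All (OpenTerm V) Ys → OpenBody V Ys
    join []       = openBody [] []
    join (openTerm {Γ} f t ∷ os) with join os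
    ... | openBody {Δ} g ts =
      openBody (All.++⁺ f g) (rename (∈-++⁺ˡ {xs = Γ}) t ∷ renames (∈-++⁺ʳ Γ) ts)

    join-value : (os : All (OpenTerm V) Ys) → prodAll value os ≈ bodyValue (join os)
    join-value [] = sym (*-identityˡ _)
    join-value (openTerm {Γ} f t ∷ os) with join os | join-value os
    ... | openBody {Δ} g ts | ih = begin-equality
      (weight t * prod b Γ) * prodAll value os          ≈⟨ *-congˡ ih ⟩
      (weight t * prod b Γ) * (weights ts * prod b Δ)   ≈⟨ *-interchange _ _ _ _ ⟩
      (weight t * weights ts) * (prod b Γ * prod b Δ)
        ≈⟨ *-cong (*-cong (reflexive (≡.sym (weight-rename _ t))) (reflexive (≡.sym (weights-rename _ ts))))
                  (sym (prod-++ b Γ Δ)) ⟩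
      (weight (rename (∈-++⁺ˡ {xs = Γ}) t) * weights (renames (∈-++⁺ʳ Γ) ts)) * prod b (Γ ++ Δ) ∎

    _except_ : List (Fin n) → Fin n → List (Fin n)
    Δ except X = filter (λ Z → ¬? (Z ≟ᶠ X)) Δ

    ⊆-except : ∀ {Z} → Z ∈ Δ → Z ∈ X ∷ Δ except X
    ⊆-except {X = X} {Z} Z∈Δ with Z ≟ᶠ X
    ... | yes Z≡X = here Z≡X
    ... | no  Z≢X = there (∈-filter⁺ (λ Z → ¬? (Z ≟ᶠ X)) Z∈Δ Z≢X)

    -- This is where absorption makes a summand linear in `b X`: one occurrence of `X` is kept and
    -- the others are bounded by `1#`.
    prod-except : X ∈ Δ → prod b Δ ≤ b X * prod b (Δ except X)
    prod-except {X} {Δ} X∈Δ = go X∈Δ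
      where
      drop : ∀ Δ → prod b Δ ≤ prod b (Δ except X)
      drop []      = ≤-refl
      drop (Z ∷ Δ) with does (Z ≟ᶠ X)
      ... | true  = ≤-trans (x*y≤y _ _) (drop Δ)
      ... | false = *-monoʳ _ (drop Δ)
      go : ∀ {Δ} → X ∈ Δ → prod b Δ ≤ b X * prod b (Δ except X)
      go {Z ∷ Δ} X∈ with Z ≟ᶠ X | X∈
      ... | yes ≡.refl | _          = *-monoʳ _ (drop Δ)
      ... | no Z≢X     | here X≡Z   = ⊥-elim (Z≢X (≡.sym X≡Z))
      ... | no Z≢X     | there X∈Δ′ = ≤-trans (*-monoʳ _ (go X∈Δ′)) (≤-reflexive (*-swap _ _ _))

    ∉-restore : ∀ {Z} → Z ∉ˢ V -ˢ X → Z ≢ X → Z ∉ˢ V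
    ∉-restore Z∉ Z≢X Z∈V = Z∉ (x∈p∧x≢y⇒x∈p-y Z∈V Z≢X)

    -- In the `linear` case `o` is not the summand itself but the loop that replaces it once the
    -- linear inequality is solved, whence the bound on `p ^∞`.
    data Classified (V : Subset n) (X : Fin n) (v : Carrier) : Set (c ⊔ ℓ) where
      constant : (o : OpenTerm V X) → v ≤ value o → Classified V X v
      linear   : ∀ p (o : OpenTerm V X) → v ≤ p * b X → p ^∞ ≤ value o → Classified V X v

    -- If `X` is among the references, a new loop binds all its occurrences at once. The slope `p`
    -- contains the other references too, and `^∞-*` reduces their infinite repetition to the single
    -- occurrence counted in `value`.
    classify : (o : OpenRule (V -ˢ X) X) → Classified V X (ruleValue o)
    classify {V} {X} (r , openBody {Δ} fresh ts) with any? (X ≟ᶠ_) Δ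
    ... | no X∉Δ = constant
      (openTerm (All.tabulate (λ Z∈ → ∉-restore {V} (All.lookup fresh Z∈) (λ { ≡.refl → X∉Δ Z∈ }))) (plain r ts))
      (≤-reflexive (sym (*-assoc _ _ _)))
    ... | yes X∈Δ = linear (q * prod b (Δ except X))
      (openTerm (All.tabulate fresh′) (loop r (renames ⊆-except ts)))
      (begin
        coeff r * (weights ts * prod b Δ)            ≈⟨ *-assoc _ _ _ ⟨
        q * prod b Δ                                 ≤⟨ *-monoʳ q (prod-except X∈Δ) ⟩
        q * (b X * prod b (Δ except X))              ≈⟨ *-congˡ (*-comm _ _) ⟩
        q * (prod b (Δ except X) * b X)              ≈⟨ *-assoc _ _ _ ⟨
        (q * prod b (Δ except X)) * b X              ∎)
      (begin
        (q * prod b (Δ except X)) ^∞                 ≤⟨ ^∞-* q _ ⟩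
        q ^∞ * prod b (Δ except X)                   ≈⟨ *-congʳ (reflexive (≡.cong (λ w → (coeff r * w) ^∞) (weights-rename _ ts))) ⟨
        (coeff r * weights (renames ⊆-except ts)) ^∞ * prod b (Δ except X) ∎)
      where
      q = coeff r * weights ts
      fresh′ : ∀ {Z} → Z ∈ Δ except X → Z ∉ˢ V
      fresh′ Z∈ with ∈-filter⁻ (λ Z → ¬? (Z ≟ᶠ X)) {xs = Δ} Z∈
      ... | Z∈Δ , Z≢X = ∉-restore {V} (All.lookup fresh Z∈Δ) Z≢X

    -- The summands are treated one by one, and `a` collects the values of the terms that replace
    -- them. Solving for one summand at a time avoids a single slope made of several rules.
    eliminate : ∀ a (os : List (OpenRule (V -ˢ X) X)) → b X ≤ a + sum ruleValue os →
                Σ (List (OpenTerm V X)) λ ts → b X ≤ a + sum value ts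
    eliminate a []       b≤ = [] , b≤
    eliminate {V} {X} a (o ∷ os) b≤ with classify {V} o
    ... | constant t v≤t with eliminate {V} (a + value t) os (begin
          b X                                  ≤⟨ b≤ ⟩
          a + (ruleValue o + sum ruleValue os) ≈⟨ +-assoc _ _ _ ⟨
          a + ruleValue o + sum ruleValue os   ≤⟨ +-mono (+-mono ≤-refl v≤t) ≤-refl ⟩
          a + value t + sum ruleValue os       ∎)
    ...   | ts , b≤′ = t ∷ ts , ≤-trans b≤′ (≤-reflexive (+-assoc _ _ _))
    eliminate {V} {X} a (o ∷ os) b≤ | linear p t v≤pb p∞≤t with eliminate {V} (a + value t) os (begin
          -- The linear summand is moved to the end and all others count as the constant part,
          -- including untreated ones that may still contain `b X`: they are fixed elements of the
          -- semiring.
          b X                                  ≤⟨ linear-post-fixed (begin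
            b X                                  ≤⟨ b≤ ⟩
            a + (ruleValue o + sum ruleValue os) ≤⟨ +-mono ≤-refl (+-mono v≤pb ≤-refl) ⟩
            a + (p * b X + sum ruleValue os)     ≈⟨ +-congˡ (+-comm _ _) ⟩
            a + (sum ruleValue os + p * b X)     ≈⟨ +-assoc _ _ _ ⟨
            a + sum ruleValue os + p * b X       ∎) ⟩
          a + sum ruleValue os + p ^∞          ≤⟨ +-mono ≤-refl p∞≤t ⟩
          a + sum ruleValue os + value t       ≈⟨ +-assoc _ _ _ ⟩
          a + (sum ruleValue os + value t)     ≈⟨ +-congˡ (+-comm _ _) ⟩
          a + (value t + sum ruleValue os)     ≈⟨ +-assoc _ _ _ ⟨
          a + value t + sum ruleValue os       ∎)
    ...   | ts , b≤′ = t ∷ ts , ≤-trans b≤′ (≤-reflexive (+-assoc _ _ _))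

    -- Gaussian elimination, with `k` as termination measure. A variable outside `V` is covered by
    -- the reference to itself. For `X` in `V`, covers over `V -ˢ X` are substituted into the
    -- polynomial of `X`, after which `X` is the only reference left to remove.
    cover-open : ∀ k (V : Subset n) → ∣ V ∣ ≤ℕ k → ∀ X → Cover (value {V} {X}) (b X)
    cover-open k V ∣V∣≤k X with X ∈? V
    cover-open k V ∣V∣≤k X | no X∉V =
      cover-single value (openTerm (X∉V ∷ []) (ref (here ≡.refl)))
        (≤-reflexive (sym (trans (*-identityˡ _) (*-identityʳ _))))
    cover-open zero V ∣V∣≤0 X | yes X∈V = ⊥-elim (ℕ.n≮0 (ℕ.<-≤-trans (x∈p⇒∣p-x∣<∣p∣ X∈V) ∣V∣≤0))
    cover-open (suc k) V ∣V∣≤k X | yes X∈V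
      with cover-map {u = ruleValue {V -ˢ X} {X}} (λ (r , os) → r , join os) (λ (r , os) → ≤-reflexive (*-congˡ (join-value os)))
             (cover-F (value {V -ˢ X}) (cover-open k (V -ˢ X) (ℕ.≤-pred (ℕ.<-≤-trans (x∈p⇒∣p-x∣<∣p∣ X∈V) ∣V∣≤k))) X)
    ... | os , Fb≤ with eliminate {V} 0# os (≤-trans (b≼Fb X) (≤-trans Fb≤ (y≤x+y _ _)))
    ...   | ts , b≤ = ts , ≤-trans b≤ (≤-reflexive (+-identityˡ _))

    closed-value≤sumAllTrees : (o : OpenTerm full X) → value o ≤ sumAllTrees K FC E X
    -- No variable lies outside `full`, so a term with an open reference is impossible here.
    closed-value≤sumAllTrees (openTerm (Z∉ ∷ _) t) = ⊥-elim (Z∉ ∈⊤)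
    closed-value≤sumAllTrees (openTerm [] t) = ≤-trans (x*y≤x _ _) (≤-trans (weight≤ydT t)
      (⨆-upper _ (unfold (close t) , unfolding-compatible (close t) , ≡.refl)))

    ≼sumAllTrees : b ≼ sumAllTrees K FC E
    ≼sumAllTrees X with cover-open ∣ full {n} ∣ full ℕ.≤-refl X
    ... | os , b≤ = ≤-trans b≤ (sum-least _ os closed-value≤sumAllTrees)

  -- Serves twice: applied to `kleene-gfp` it helps identify the tree sum with a fixed point, and
  -- applied to any other fixed point it shows that this one is the greatest.
  fixed≼sumAllTrees : ∀ b → IsFixedPoint K E b → b ≼ sumAllTrees K FC E
  fixed≼sumAllTrees b fixed = PostFixedPoint.≼sumAllTrees b (λ X → ≤-reflexive (sym (fixed X)))

theorem17 : {c ℓ : Level} (K : CommutativeSemiring c ℓ) → Absorptive K →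
    (FC : FullyContinuous K) → (n : ℕ) → (E : System K n) → WellFormedSystem K E →
    IsLfp K E (sumFiniteTrees K FC E) × IsGfp K E (sumAllTrees K FC E)
theorem17 K absorptive FC n E _ =
  ( fixed-resp kleene-lfp≼sumFiniteTrees sumFiniteTrees≼kleene-lfp kleene-lfp-fixed
  , λ b fixed X → ≤-trans (sumFiniteTrees≼kleene-lfp X) (kleene-lfp-least b fixed X) ) ,
  ( fixed-resp (fixed≼sumAllTrees kleene-gfp kleene-gfp-fixed) sumAllTrees≼kleene-gfp kleene-gfp-fixed
  , fixed≼sumAllTrees )
  where open Approximation K absorptive FC E
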